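{- Let $G$ be a finite connected undirected simple graph with vertex set $V(G)$ and edge set $E(G)$, let $o$ be an alternating orientation of $G$, and let $(G,o)$ be the resulting directed graph. Then \[ \mathrm{rk}\,\mathrm{MH}_{k,l}(G,o)=\mathrm{rk}\,\mathrm{EMH}_{k,l}(G,o)= \begin{cases} |V(G)| & \text{if } (k,l)=(0,0),\\ |E(G)| & \text{if } (k,l)=(1,1),\\ 0 & \text{otherwise.} \end{cases} \] In particular, $(G,o)$ is both diagonal and regularly diagonal.
   Context: $R$ is a fixed nonzero commutative unital ring; rank means rank as a free $R$-module. An orientation $o$ of an undirected graph (a choice of one direction for each edge) is alternating if there is a partition $V\sqcup W$ of the vertices such that all elements of $V$ have indegree $0$ and all elements of $W$ have outdegree $0$. For a directed graph $D$, $d_D(x,y)$ is the minimal length of a directed path from $x$ to $y$ ($\infty$ if none), and $\mathrm{len}(x_0,\dots,x_k)=\sum_{i=0}^{k-1}d_D(x_i,x_{i+1})$ when all terms are finite. $\mathrm{MC}_{k,l}(D)$ is the free $R$-module on tuples $(x_0,\dots,x_k)$ of vertices with $x_i\ne x_{i+1}$ and $d_D(x_i,x_{i+1})<\infty$ for all $i$ and length $l$; $\mathrm{EMC}_{k,l}(D)$ is the submodule spanned by those tuples whose entries are pairwise distinct. The differential on both is $\partial=\sum_{i=1}^{k-1}(-1)^i\partial_i$, where $\partial_i$ deletes $x_i$ if the resulting tuple still has length $l$ and is $0$ otherwise. $\mathrm{MH}_{k,l}(D)=H_k(\mathrm{MC}_{*,l}(D))$ and $\mathrm{EMH}_{k,l}(D)=H_k(\mathrm{EMC}_{*,l}(D))$.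 $D$ is diagonal if $\mathrm{MH}_{k,l}(D)=0$ for all $k\ne l$, and regularly diagonal if $\mathrm{EMH}_{k,l}(D)=0$ for all $k\neq l$. -}

module Defs where

open import Algebra.Bundles using (CommutativeMonoid; CommutativeRing)
open import Algebra.Module.Bundles using (LeftModule)
import Algebra.Module.Construct.Zero as Zero
import Algebra.Module.Morphism.Structures as Morphisms
import Algebra.Properties.CommutativeMonoid.Sum as Sum
import Algebra.Properties.Semiring.Exp as Exp
import Algebra.Properties.CommutativeSemigroup as CommutativeSemigroupProperties
import Relation.Binary.Reasoning.Setoid as SetoidReasoning
open import Data.Empty using (⊥-elim)
open import Data.Fin.Base as Fin using (Fin; zero; suc; toℕ; inject₁)
import Data.Fin.Properties as Fin
open import Data.Fin.Subset using (Subset; _∈_; ∁)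
open import Data.List.Base using (List; length; filter; allFin; cartesianProduct)
open import Data.Nat.Base using (ℕ; zero; suc; _+_; _∸_; _<_; s≤s)
open import Data.Nat.Properties
  using (anyUpTo?; allUpTo?; <-cmp; +-assoc; m+n≡0⇒m≡0; +-cancelʳ-≡; +-cancelˡ-≡; m≤m+n; m+n∸m≡n; m+[n∸m]≡n; ≤-pred)
  renaming (_≟_ to _≟ℕ_)
open import Data.Product.Base using (∃; _×_; _,_; proj₁)
open import Data.Sum.Base using (_⊎_; inj₁; inj₂)
open import Data.Vec.Base using (Vec; []; _∷_; removeAt)
open import Data.Vec.Relation.Unary.All using (All; []; _∷_)
open import Data.Vec.Relation.Unary.AllPairs.Core using ([]; _∷_)
open import Data.Vec.Relation.Unary.Linked using (Linked; _∷_)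
open import Data.Vec.Relation.Unary.Unique.Propositional using (Unique)
open import Level as Level using (Level; _⊔_; 0ℓ)
open import Relation.Binary.Core using (Rel)
open import Relation.Binary.Definitions using (Decidable; Symmetric; tri<; tri≈; tri>)
open import Relation.Binary.PropositionalEquality
  using (_≡_; _≢_; refl; sym; trans; subst)
open import Relation.Nullary using (¬_; Dec; yes; no)
open import Relation.Nullary.Decidable using (map′; _×-dec_; ¬?)
open import Relation.Unary using (Pred)

data Walk {V : Set} (_⟶_ : Rel V 0ℓ) : ℕ → V → V → Set where
  []  : ∀ {x} → Walk _⟶_ 0 x x
  _∷_ : ∀ {m x y z} → x ⟶ y → Walk _⟶_ m y z → Walk _⟶_ (suc m) x z

record Graph (n : ℕ) : Set₁ where
  field
    Adj     : Rel (Fin n) 0ℓ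
    adj?    : Decidable Adj
    adj-sym : Symmetric Adj
    irrefl  : ∀ {x} → ¬ Adj x x

  Connected : Set
  Connected = ∀ x y → ∃ λ m → Walk Adj m x y

  -- Each unordered edge {x , y} is listed once, as the pair with x < y.
  edges : List (Fin n × Fin n)
  edges = filter (λ (x , y) → (x Fin.<? y) ×-dec adj? x y)
                 (cartesianProduct (allFin n) (allFin n))

  ∣V∣ ∣E∣ : ℕ
  ∣V∣ = n
  ∣E∣ = length edges

record Digraph (n : ℕ) : Set₁ where
  field
    Arc  : Rel (Fin n) 0ℓ
    arc? : Decidable Arc

  indegree outdegree : Fin n → ℕ
  indegree  x = length (filter (λ y → arc? y x) (allFin n))
  outdegree x = length (filter (λ y → arc? x y) (allFin n))

-- Arc is decidable because adjacency is: see digraph.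
record Orientation {n} (G : Graph n) : Set₁ where
  open Graph G
  field
    Arc     : Rel (Fin n) 0ℓ
    arc⇒adj : ∀ {x y} → Arc x y → Adj x y
    choice  : ∀ {x y} → Adj x y → Arc x y ⊎ Arc y x
    asym    : ∀ {x y} → Arc x y → ¬ Arc y x

  digraph : Digraph n
  digraph = record { Arc = Arc ; arc? = arc? }
    where
    arc? : Decidable Arc
    arc? x y with adj? x y
    ... | no ¬e = no λ a → ¬e (arc⇒adj a)
    ... | yes e with choice e
    ...   | inj₁ a = yes a
    ...   | inj₂ b = no (asym b)

Alternating : ∀ {n} {G : Graph n} → Orientation G → Set
Alternating {n} o = ∃ λ (V : Subset n) →
    (∀ x → x ∈ V   → indegree  x ≡ 0)
  × (∀ x → x ∈ ∁ V → outdegree x ≡ 0)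
  where open Digraph (Orientation.digraph o)

module _ {n} (D : Digraph n) where
  open Digraph D

  -- Dist x y m states d(x , y) = m; d(x , y) = ∞ means that no m satisfies it.
  Dist : Fin n → Fin n → ℕ → Set
  Dist x y m = Walk Arc m x y × (∀ {j} → j < m → ¬ Walk Arc j x y)

  -- Len t l states that all consecutive distances are finite, with sum l.
  data Len : ∀ {k} → Vec (Fin n) (suc k) → ℕ → Set where
    [-] : ∀ {x} → Len (x ∷ []) 0
    _∷_ : ∀ {k x y a b} {xs : Vec (Fin n) k} →
          Dist x y a → Len (y ∷ xs) b → Len (x ∷ y ∷ xs) (a + b)

  -- The proofs are irrelevant: generators with the same tuple are equal.
  record Generator (k l : ℕ) : Set where
    constructor generator
    field
      tuple   : Vec (Fin n) (suc k)
      .proper : Linked _≢_ tuple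
      .len    : Len tuple l

  walk? : ∀ m x y → Dec (Walk Arc m x y)
  walk? zero    x y = map′ (λ { refl → [] }) (λ { [] → refl }) (x Fin.≟ y)
  walk? (suc m) x z = map′ (λ (_ , a , w) → a ∷ w) (λ { (a ∷ w) → _ , a , w })
                           (Fin.any? λ y → arc? x y ×-dec walk? m y z)

  dist? : ∀ x y m → Dec (Dist x y m)
  dist? x y m = walk? m x y ×-dec allUpTo? (λ j → ¬? (walk? j x y)) m

  len? : ∀ {k} (t : Vec (Fin n) (suc k)) l → Dec (Len t l)
  len? (x ∷ [])     l = map′ (λ { refl → [-] }) (λ { [-] → refl }) (l ≟ℕ 0)
  len? (x ∷ y ∷ xs) l = map′ to from
    (anyUpTo? (λ a → dist? x y a ×-dec len? (y ∷ xs) (l ∸ a)) (suc l))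
    where
    to : (∃ λ a → a < suc l × Dist x y a × Len (y ∷ xs) (l ∸ a)) → Len (x ∷ y ∷ xs) l
    to (a , a≤l , d , p) = subst (Len _) (m+[n∸m]≡n (≤-pred a≤l)) (d ∷ p)

    from : ∀ {l} → Len (x ∷ y ∷ xs) l → ∃ λ a → a < suc l × Dist x y a × Len (y ∷ xs) (l ∸ a)
    from (_∷_ {a = a} {b} d p) =
      a , s≤s (m≤m+n a b) , d , subst (Len _) (sym (m+n∸m≡n a b)) p

  dist-unique : ∀ {x y a b} → Dist x y a → Dist x y b → a ≡ b
  dist-unique {a = a} {b} (v , v-min) (w , w-min) with <-cmp a b
  ... | tri< a<b _ _ = ⊥-elim (w-min a<b v)
  ... | tri≈ _ a≡b _ = a≡b
  ... | tri> _ _ b<a = ⊥-elim (v-min b<a w)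

  dist0⇒≡ : ∀ {x y} → Dist x y 0 → x ≡ y
  dist0⇒≡ ([] , _) = refl

  len-unique : ∀ {k a b} {t : Vec (Fin n) (suc k)} → Len t a → Len t b → a ≡ b
  len-unique [-]     [-]     = refl
  len-unique (d ∷ p) (e ∷ q) with dist-unique d e | len-unique p q
  ... | refl | refl = refl

  -- Deleting an interior entry without changing the length cannot create
  -- equal neighbours, since distinct vertices are at positive distance.
  proper-removeAt : ∀ {m a b} (t : Vec (Fin n) (suc (suc m))) (i : Fin m) →
    Linked _≢_ t → Len t a → Len (removeAt t (suc (inject₁ i))) b → a ≡ b →
    Linked _≢_ (removeAt t (suc (inject₁ i)))
  proper-removeAt {suc m} (x ∷ y ∷ z ∷ xs) zero (x≢y ∷ _ ∷ xs≢)
                  (_∷_ {a = a} d (_∷_ {a = b} {c} _ p)) (f ∷ q) eq = x≢z f q eq ∷ xs≢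
    where
    x≢z : ∀ {a′ c′} → Dist x z a′ → Len (z ∷ xs) c′ → a + (b + c) ≡ a′ + c′ → x ≢ z
    x≢z f q eq refl with dist-unique f ([] , λ ()) | len-unique p q
    ... | refl | refl = x≢y (dist0⇒≡ (subst (Dist x y) a≡0 d))
      where
      a≡0 : a ≡ 0
      a≡0 = m+n≡0⇒m≡0 a (+-cancelʳ-≡ c (a + b) 0 (trans (+-assoc a b c) eq))
  proper-removeAt {suc m} (x ∷ y ∷ z ∷ xs) (suc i) (x≢y ∷ ts≢) (d ∷ p) (e ∷ q) eq
    with dist-unique d e
  ... | refl = x≢y ∷ proper-removeAt (y ∷ z ∷ xs) i ts≢ p q (+-cancelˡ-≡ _ _ _ eq)

unique-removeAt : ∀ {A : Set} {m} {t : Vec A (suc m)} (i : Fin (suc m)) →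
                  Unique t → Unique (removeAt t i)
unique-removeAt zero (_ ∷ u) = u
unique-removeAt {t = _ ∷ _ ∷ _} (suc i) (ps ∷ u) = all-removeAt i ps ∷ unique-removeAt i u
  where
  all-removeAt : ∀ {A : Set} {P : Pred A 0ℓ} {m} {t : Vec A (suc m)} (i : Fin (suc m)) →
                 All P t → All P (removeAt t i)
  all-removeAt zero (_ ∷ ps) = ps
  all-removeAt {t = _ ∷ _ ∷ _} (suc i) (p ∷ ps) = p ∷ all-removeAt i ps

module _ {c ℓ} (R : CommutativeRing c ℓ) where
  open CommutativeRing R
    using (ring; semiring; 0#; 1#; -_)
    renaming (Carrier to ∣R∣; _≈_ to _≈ᴿ_; _+_ to _+ᴿ_; _*_ to _*ᴿ_)

  Mod : (m ℓm : Level) → Set (c ⊔ ℓ ⊔ Level.suc (m ⊔ ℓm))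
  Mod = LeftModule ring

  record LinearMap {a ℓa b ℓb} (A : Mod a ℓa) (B : Mod b ℓb) : Set (c ⊔ a ⊔ ℓa ⊔ b ⊔ ℓb) where
    open Morphisms.LeftModuleMorphisms (LeftModule.rawLeftModule A) (LeftModule.rawLeftModule B)
    field
      ⟦_⟧    : LeftModule.Carrierᴹ A → LeftModule.Carrierᴹ B
      linear : IsLeftModuleHomomorphism ⟦_⟧
    open IsLeftModuleHomomorphism linear public

  mkLinear : ∀ {a ℓa b ℓb} (A : Mod a ℓa) (B : Mod b ℓb) →
    let module A = LeftModule A
        module B = LeftModule B
    in
    (f : A.Carrierᴹ → B.Carrierᴹ) →
    (∀ {x y} → x A.≈ᴹ y → f x B.≈ᴹ f y) →
    (∀ x y → f (x A.+ᴹ y) B.≈ᴹ f x B.+ᴹ f y) →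
    f A.0ᴹ B.≈ᴹ B.0ᴹ →
    (∀ x → f (A.-ᴹ x) B.≈ᴹ B.-ᴹ f x) →
    (∀ r x → f (r A.*ₗ x) B.≈ᴹ r B.*ₗ f x) →
    LinearMap A B
  mkLinear A B f f-cong f-+ f-0 f-neg f-* = record
    { ⟦_⟧    = f
    ; linear = record
      { +ᴹ-isGroupHomomorphism = record
        { isMonoidHomomorphism = record
          { isMagmaHomomorphism = record
            { isRelHomomorphism = record { cong = f-cong }
            ; homo = f-+
            }
          ; ε-homo = f-0
          }
        ; ⁻¹-homo = f-neg
        }
      ; *ₗ-homo = f-*
      }
    }

  module _ {m ℓm} (M : Mod m ℓm) where
    open LeftModule M
    open Sum +ᴹ-commutativeMonoid using (sum)

    record IsBasis {r} (b : Fin r → Carrierᴹ) : Set (c ⊔ ℓ ⊔ m ⊔ ℓm) where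
      field
        spanning    : ∀ x → ∃ λ (a : Fin r → ∣R∣) → x ≈ᴹ sum (λ i → a i *ₗ b i)
        independent : ∀ (a : Fin r → ∣R∣) → sum (λ i → a i *ₗ b i) ≈ᴹ 0ᴹ → ∀ i → a i ≈ᴿ 0#

    HasRank : ℕ → Set (c ⊔ ℓ ⊔ m ⊔ ℓm)
    HasRank r = ∃ λ (b : Fin r → Carrierᴹ) → IsBasis b

    IsZero : Set (m ⊔ ℓm)
    IsZero = ∀ x → x ≈ᴹ 0ᴹ

  -- The free module on a set: formal expressions modulo the congruence generated
  -- by the module laws.

  module _ {t} (T : Set t) where

    data Term : Set (c ⊔ t) where
      gen : T → Term
      𝟎   : Term
      _⊕_ : Term → Term → Term
      ⊖_  : Term → Term
      _⊙_ : ∣R∣ → Term → Term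

    infix 4 _≋_
    data _≋_ : Term → Term → Set (c ⊔ ℓ ⊔ t) where
      ≋-refl  : ∀ {x} → x ≋ x
      ≋-sym   : ∀ {x y} → x ≋ y → y ≋ x
      ≋-trans : ∀ {x y z} → x ≋ y → y ≋ z → x ≋ z
      ⊕-cong  : ∀ {x x′ y y′} → x ≋ x′ → y ≋ y′ → (x ⊕ y) ≋ (x′ ⊕ y′)
      ⊖-cong  : ∀ {x x′} → x ≋ x′ → (⊖ x) ≋ (⊖ x′)
      ⊙-cong  : ∀ {r r′ x x′} → r ≈ᴿ r′ → x ≋ x′ → (r ⊙ x) ≋ (r′ ⊙ x′)
      ⊕-assoc     : ∀ x y z → ((x ⊕ y) ⊕ z) ≋ (x ⊕ (y ⊕ z))
      ⊕-comm      : ∀ x y → (x ⊕ y) ≋ (y ⊕ x)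
      ⊕-identityˡ : ∀ x → (𝟎 ⊕ x) ≋ x
      ⊖-inverseˡ  : ∀ x → ((⊖ x) ⊕ x) ≋ 𝟎
      ⊙-zeroˡ     : ∀ x → (0# ⊙ x) ≋ 𝟎
      ⊙-zeroʳ     : ∀ r → (r ⊙ 𝟎) ≋ 𝟎
      ⊙-identityˡ : ∀ x → (1# ⊙ x) ≋ x
      ⊙-assoc     : ∀ r s x → ((r *ᴿ s) ⊙ x) ≋ (r ⊙ (s ⊙ x))
      ⊙-distribˡ  : ∀ r x y → (r ⊙ (x ⊕ y)) ≋ ((r ⊙ x) ⊕ (r ⊙ y))
      ⊙-distribʳ  : ∀ x r s → ((r +ᴿ s) ⊙ x) ≋ ((r ⊙ x) ⊕ (s ⊙ x))

    Free : Mod (c ⊔ t) (c ⊔ ℓ ⊔ t)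
    Free = record
      { Carrierᴹ = Term ; _≈ᴹ_ = _≋_ ; _+ᴹ_ = _⊕_ ; _*ₗ_ = _⊙_ ; 0ᴹ = 𝟎 ; -ᴹ_ = ⊖_
      ; isLeftModule = record
        { isLeftSemimodule = record
          { +ᴹ-isCommutativeMonoid = record
            { isMonoid = record
              { isSemigroup = record
                { isMagma = record
                  { isEquivalence = record { refl = ≋-refl ; sym = ≋-sym ; trans = ≋-trans }
                  ; ∙-cong = ⊕-cong
                  }
                ; assoc = ⊕-assoc
                }
              ; identity = ⊕-identityˡ , λ x → ≋-trans (⊕-comm x 𝟎) (⊕-identityˡ x)
              }
            ; comm = ⊕-comm
            }
          ; isPreleftSemimodule = record
            { *ₗ-cong      = ⊙-cong
            ; *ₗ-zeroˡ     = ⊙-zeroˡ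
            ; *ₗ-distribʳ  = ⊙-distribʳ
            ; *ₗ-identityˡ = ⊙-identityˡ
            ; *ₗ-assoc     = ⊙-assoc
            ; *ₗ-zeroʳ     = ⊙-zeroʳ
            ; *ₗ-distribˡ  = ⊙-distribˡ
            }
          }
        ; -ᴹ‿cong    = ⊖-cong
        ; -ᴹ‿inverse = ⊖-inverseˡ , λ x → ≋-trans (⊕-comm x (⊖ x)) (⊖-inverseˡ x)
        }
      }

  module _ {t m ℓm} {T : Set t} (M : Mod m ℓm) (f : T → LeftModule.Carrierᴹ M) where
    open LeftModule M

    extend-fun : Term T → Carrierᴹ
    extend-fun (gen x) = f x
    extend-fun 𝟎       = 0ᴹ
    extend-fun (x ⊕ y) = extend-fun x +ᴹ extend-fun y
    extend-fun (⊖ x)   = -ᴹ extend-fun x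
    extend-fun (r ⊙ x) = r *ₗ extend-fun x

    extend-cong : ∀ {x y} → _≋_ T x y → extend-fun x ≈ᴹ extend-fun y
    extend-cong ≋-refl             = ≈ᴹ-refl
    extend-cong (≋-sym p)          = ≈ᴹ-sym (extend-cong p)
    extend-cong (≋-trans p q)      = ≈ᴹ-trans (extend-cong p) (extend-cong q)
    extend-cong (⊕-cong p q)       = +ᴹ-cong (extend-cong p) (extend-cong q)
    extend-cong (⊖-cong p)         = -ᴹ‿cong (extend-cong p)
    extend-cong (⊙-cong r p)       = *ₗ-cong r (extend-cong p)
    extend-cong (⊕-assoc x y z)    = +ᴹ-assoc _ _ _
    extend-cong (⊕-comm x y)       = +ᴹ-comm _ _
    extend-cong (⊕-identityˡ x)    = +ᴹ-identityˡ _
    extend-cong (⊖-inverseˡ x)     = -ᴹ‿inverseˡ _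
    extend-cong (⊙-zeroˡ x)        = *ₗ-zeroˡ _
    extend-cong (⊙-zeroʳ r)        = *ₗ-zeroʳ _
    extend-cong (⊙-identityˡ x)    = *ₗ-identityˡ _
    extend-cong (⊙-assoc r s x)    = *ₗ-assoc _ _ _
    extend-cong (⊙-distribˡ r x y) = *ₗ-distribˡ _ _ _
    extend-cong (⊙-distribʳ x r s) = *ₗ-distribʳ _ _ _

    extend : LinearMap (Free T) M
    extend = mkLinear (Free T) M extend-fun extend-cong
      (λ _ _ → ≈ᴹ-refl) ≈ᴹ-refl (λ _ → ≈ᴹ-refl) (λ _ _ → ≈ᴹ-refl)

  module _ {m ℓm s} (M : Mod m ℓm) (S : Pred (LeftModule.Carrierᴹ M) s) where
    open LeftModule M

    data InSpan : Carrierᴹ → Set (c ⊔ m ⊔ ℓm ⊔ s) where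
      incl  : ∀ {x} → S x → InSpan x
      zeroˢ : InSpan 0ᴹ
      addˢ  : ∀ {x y} → InSpan x → InSpan y → InSpan (x +ᴹ y)
      negˢ  : ∀ {x} → InSpan x → InSpan (-ᴹ x)
      scalˢ : ∀ r {x} → InSpan x → InSpan (r *ₗ x)
      respˢ : ∀ {x y} → x ≈ᴹ y → InSpan x → InSpan y

    Span : Mod (c ⊔ m ⊔ ℓm ⊔ s) ℓm
    Span = record
      { Carrierᴹ = ∃ InSpan
      ; _≈ᴹ_ = λ x y → proj₁ x ≈ᴹ proj₁ y
      ; _+ᴹ_ = λ (x , p) (y , q) → x +ᴹ y , addˢ p q
      ; _*ₗ_ = λ r (x , p) → r *ₗ x , scalˢ r p
      ; 0ᴹ   = 0ᴹ , zeroˢ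
      ; -ᴹ_  = λ (x , p) → -ᴹ x , negˢ p
      ; isLeftModule = record
        { isLeftSemimodule = record
          { +ᴹ-isCommutativeMonoid = record
            { isMonoid = record
              { isSemigroup = record
                { isMagma = record
                  { isEquivalence = record { refl = ≈ᴹ-refl ; sym = ≈ᴹ-sym ; trans = ≈ᴹ-trans }
                  ; ∙-cong = +ᴹ-cong
                  }
                ; assoc = λ _ _ _ → +ᴹ-assoc _ _ _
                }
              ; identity = (λ _ → +ᴹ-identityˡ _) , λ _ → +ᴹ-identityʳ _
              }
            ; comm = λ _ _ → +ᴹ-comm _ _
            }
          ; isPreleftSemimodule = record
            { *ₗ-cong      = *ₗ-cong
            ; *ₗ-zeroˡ     = λ _ → *ₗ-zeroˡ _
            ; *ₗ-distribʳ  = λ _ _ _ → *ₗ-distribʳ _ _ _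
            ; *ₗ-identityˡ = λ _ → *ₗ-identityˡ _
            ; *ₗ-assoc     = λ _ _ _ → *ₗ-assoc _ _ _
            ; *ₗ-zeroʳ     = λ _ → *ₗ-zeroʳ _
            ; *ₗ-distribˡ  = λ _ _ _ → *ₗ-distribˡ _ _ _
            }
          }
        ; -ᴹ‿cong    = -ᴹ‿cong
        ; -ᴹ‿inverse = (λ _ → -ᴹ‿inverseˡ _) , λ _ → -ᴹ‿inverseʳ _
        }
      }

  module _ {a ℓa b ℓb s s′} {A : Mod a ℓa} {B : Mod b ℓb}
           (S : Pred (LeftModule.Carrierᴹ A) s) (S′ : Pred (LeftModule.Carrierᴹ B) s′)
           (f : LinearMap A B)
           (f-S : ∀ {x} → S x → InSpan B S′ (LinearMap.⟦_⟧ f x)) where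
    open LinearMap f
    private
      module A = LeftModule A
      module B = LeftModule B

    restrict-span : ∀ {x} → InSpan A S x → InSpan B S′ ⟦ x ⟧
    restrict-span (incl p)    = f-S p
    restrict-span zeroˢ       = respˢ (B.≈ᴹ-sym 0ᴹ-homo) zeroˢ
    restrict-span (addˢ p q)  = respˢ (B.≈ᴹ-sym (+ᴹ-homo _ _)) (addˢ (restrict-span p) (restrict-span q))
    restrict-span (negˢ p)    = respˢ (B.≈ᴹ-sym (-ᴹ-homo _)) (negˢ (restrict-span p))
    restrict-span (scalˢ r p) = respˢ (B.≈ᴹ-sym (*ₗ-homo r _)) (scalˢ r (restrict-span p))
    restrict-span (respˢ e p) = respˢ (⟦⟧-cong e) (restrict-span p)

    restrict : LinearMap (Span A S) (Span B S′)
    restrict = mkLinear (Span A S) (Span B S′)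
      (λ (x , p) → ⟦ x ⟧ , restrict-span p)
      ⟦⟧-cong (λ _ _ → +ᴹ-homo _ _) 0ᴹ-homo (λ _ → -ᴹ-homo _) (λ r _ → *ₗ-homo r _)

  -- The homology ker g / im f at the middle term of A → B → C.  Elements are
  -- cycles, and equality of cycles is congruence modulo im f.  The relation g ∘ f = 0
  -- is not needed to form this setoid quotient: f w enters only as a difference
  -- of two cycles, so in general this is ker g / (ker g ∩ im f).

  module _ {a ℓa b ℓb d ℓd} {A : Mod a ℓa} {B : Mod b ℓb} {C : Mod d ℓd}
           (f : LinearMap A B) (g : LinearMap B C) where
    private
      module A = LeftModule A
      module B = LeftModule B
      module C = LeftModule C
      module f = LinearMap f
      module g = LinearMap g
      open SetoidReasoning B.≈ᴹ-setoid
      open CommutativeSemigroupProperties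
        (CommutativeMonoid.commutativeSemigroup B.+ᴹ-commutativeMonoid)
        using (interchange)

    Cycle : Set (b ⊔ ℓd)
    Cycle = ∃ λ x → g.⟦ x ⟧ C.≈ᴹ C.0ᴹ

    _~_ : Rel Cycle (a ⊔ ℓb)
    (x , _) ~ (y , _) = ∃ λ w → x B.≈ᴹ y B.+ᴹ f.⟦ w ⟧

    private
      ≈⇒~ : ∀ {x y} → x B.≈ᴹ y → ∃ λ w → x B.≈ᴹ y B.+ᴹ f.⟦ w ⟧
      ≈⇒~ {x} {y} x≈y = A.0ᴹ , (begin
        x                    ≈⟨ x≈y ⟩
        y                    ≈⟨ B.+ᴹ-identityʳ y ⟨
        y B.+ᴹ B.0ᴹ          ≈⟨ B.+ᴹ-congˡ f.0ᴹ-homo ⟨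
        y B.+ᴹ f.⟦ A.0ᴹ ⟧    ∎)

      ~-sym : ∀ {x y} → (∃ λ w → x B.≈ᴹ y B.+ᴹ f.⟦ w ⟧) → ∃ λ w → y B.≈ᴹ x B.+ᴹ f.⟦ w ⟧
      ~-sym {x} {y} (w , e) = A.-ᴹ w , B.≈ᴹ-sym (begin
        x B.+ᴹ f.⟦ A.-ᴹ w ⟧                    ≈⟨ B.+ᴹ-cong e (f.-ᴹ-homo w) ⟩
        (y B.+ᴹ f.⟦ w ⟧) B.+ᴹ (B.-ᴹ f.⟦ w ⟧)   ≈⟨ B.+ᴹ-assoc _ _ _ ⟩
        y B.+ᴹ (f.⟦ w ⟧ B.+ᴹ (B.-ᴹ f.⟦ w ⟧))   ≈⟨ B.+ᴹ-congˡ (B.-ᴹ‿inverseʳ _) ⟩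
        y B.+ᴹ B.0ᴹ                            ≈⟨ B.+ᴹ-identityʳ y ⟩
        y                                      ∎)

      ~-trans : ∀ {x y z} → (∃ λ w → x B.≈ᴹ y B.+ᴹ f.⟦ w ⟧) →
                (∃ λ w → y B.≈ᴹ z B.+ᴹ f.⟦ w ⟧) → ∃ λ w → x B.≈ᴹ z B.+ᴹ f.⟦ w ⟧
      ~-trans {x} {y} {z} (v , e) (w , e′) = w A.+ᴹ v , (begin
        x                                   ≈⟨ e ⟩
        y B.+ᴹ f.⟦ v ⟧                      ≈⟨ B.+ᴹ-congʳ e′ ⟩
        (z B.+ᴹ f.⟦ w ⟧) B.+ᴹ f.⟦ v ⟧       ≈⟨ B.+ᴹ-assoc _ _ _ ⟩
        z B.+ᴹ (f.⟦ w ⟧ B.+ᴹ f.⟦ v ⟧)       ≈⟨ B.+ᴹ-congˡ (f.+ᴹ-homo w v) ⟨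
        z B.+ᴹ f.⟦ w A.+ᴹ v ⟧               ∎)

      ~-+ : ∀ {x y x′ y′} → (∃ λ w → x B.≈ᴹ y B.+ᴹ f.⟦ w ⟧) →
            (∃ λ w → x′ B.≈ᴹ y′ B.+ᴹ f.⟦ w ⟧) →
            ∃ λ w → x B.+ᴹ x′ B.≈ᴹ (y B.+ᴹ y′) B.+ᴹ f.⟦ w ⟧
      ~-+ {x} {y} {x′} {y′} (v , e) (w , e′) = v A.+ᴹ w , (begin
        x B.+ᴹ x′                                  ≈⟨ B.+ᴹ-cong e e′ ⟩
        (y B.+ᴹ f.⟦ v ⟧) B.+ᴹ (y′ B.+ᴹ f.⟦ w ⟧)    ≈⟨ interchange _ _ _ _ ⟩
        (y B.+ᴹ y′) B.+ᴹ (f.⟦ v ⟧ B.+ᴹ f.⟦ w ⟧)    ≈⟨ B.+ᴹ-congˡ (f.+ᴹ-homo v w) ⟨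
        (y B.+ᴹ y′) B.+ᴹ f.⟦ v A.+ᴹ w ⟧            ∎)

      ~-* : ∀ {r r′ x y} → r ≈ᴿ r′ → (∃ λ w → x B.≈ᴹ y B.+ᴹ f.⟦ w ⟧) →
            ∃ λ w → r B.*ₗ x B.≈ᴹ (r′ B.*ₗ y) B.+ᴹ f.⟦ w ⟧
      ~-* {r} {r′} {x} {y} r≈r′ (w , e) = r′ A.*ₗ w , (begin
        r B.*ₗ x                                ≈⟨ B.*ₗ-cong r≈r′ e ⟩
        r′ B.*ₗ (y B.+ᴹ f.⟦ w ⟧)                ≈⟨ B.*ₗ-distribˡ r′ _ _ ⟩
        (r′ B.*ₗ y) B.+ᴹ (r′ B.*ₗ f.⟦ w ⟧)      ≈⟨ B.+ᴹ-congˡ (f.*ₗ-homo r′ w) ⟨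
        (r′ B.*ₗ y) B.+ᴹ f.⟦ r′ A.*ₗ w ⟧        ∎)

      ~-neg : ∀ {x y} → (∃ λ w → x B.≈ᴹ y B.+ᴹ f.⟦ w ⟧) →
              ∃ λ w → B.-ᴹ x B.≈ᴹ (B.-ᴹ y) B.+ᴹ f.⟦ w ⟧
      ~-neg {x} {y} p with ~-sym p
      ... | w , e = w , (begin
        B.-ᴹ x                                        ≈⟨ B.+ᴹ-identityˡ _ ⟨
        B.0ᴹ B.+ᴹ (B.-ᴹ x)                            ≈⟨ B.+ᴹ-congʳ (B.-ᴹ‿inverseˡ y) ⟨
        ((B.-ᴹ y) B.+ᴹ y) B.+ᴹ (B.-ᴹ x)               ≈⟨ B.+ᴹ-assoc _ _ _ ⟩
        (B.-ᴹ y) B.+ᴹ (y B.+ᴹ (B.-ᴹ x))               ≈⟨ B.+ᴹ-congˡ (B.+ᴹ-congʳ (B.≈ᴹ-trans e (B.+ᴹ-comm _ _))) ⟩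
        (B.-ᴹ y) B.+ᴹ ((f.⟦ w ⟧ B.+ᴹ x) B.+ᴹ (B.-ᴹ x)) ≈⟨ B.+ᴹ-congˡ (B.+ᴹ-assoc _ _ _) ⟩
        (B.-ᴹ y) B.+ᴹ (f.⟦ w ⟧ B.+ᴹ (x B.+ᴹ (B.-ᴹ x))) ≈⟨ B.+ᴹ-congˡ (B.+ᴹ-congˡ (B.-ᴹ‿inverseʳ x)) ⟩
        (B.-ᴹ y) B.+ᴹ (f.⟦ w ⟧ B.+ᴹ B.0ᴹ)             ≈⟨ B.+ᴹ-congˡ (B.+ᴹ-identityʳ _) ⟩
        (B.-ᴹ y) B.+ᴹ f.⟦ w ⟧                         ∎)

      -0≈0 : C.-ᴹ C.0ᴹ C.≈ᴹ C.0ᴹ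
      -0≈0 = C.≈ᴹ-trans (C.≈ᴹ-sym (C.+ᴹ-identityʳ _)) (C.-ᴹ‿inverseˡ C.0ᴹ)

    Homology : Mod (b ⊔ ℓd) (a ⊔ ℓb)
    Homology = record
      { Carrierᴹ = Cycle
      ; _≈ᴹ_ = _~_
      ; _+ᴹ_ = λ (x , p) (y , q) → x B.+ᴹ y ,
                 C.≈ᴹ-trans (g.+ᴹ-homo x y) (C.≈ᴹ-trans (C.+ᴹ-cong p q) (C.+ᴹ-identityˡ _))
      ; _*ₗ_ = λ r (x , p) → r B.*ₗ x ,
                 C.≈ᴹ-trans (g.*ₗ-homo r x) (C.≈ᴹ-trans (C.*ₗ-congˡ p) (C.*ₗ-zeroʳ r))
      ; 0ᴹ   = B.0ᴹ , g.0ᴹ-homo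
      ; -ᴹ_  = λ (x , p) → B.-ᴹ x ,
                 C.≈ᴹ-trans (g.-ᴹ-homo x) (C.≈ᴹ-trans (C.-ᴹ‿cong p) -0≈0)
      ; isLeftModule = record
        { isLeftSemimodule = record
          { +ᴹ-isCommutativeMonoid = record
            { isMonoid = record
              { isSemigroup = record
                { isMagma = record
                  { isEquivalence = record
                    { refl = ≈⇒~ B.≈ᴹ-refl ; sym = ~-sym ; trans = ~-trans }
                  ; ∙-cong = ~-+
                  }
                ; assoc = λ _ _ _ → ≈⇒~ (B.+ᴹ-assoc _ _ _)
                }
              ; identity = (λ _ → ≈⇒~ (B.+ᴹ-identityˡ _)) , λ _ → ≈⇒~ (B.+ᴹ-identityʳ _)
              }
            ; comm = λ _ _ → ≈⇒~ (B.+ᴹ-comm _ _)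
            }
          ; isPreleftSemimodule = record
            { *ₗ-cong      = ~-*
            ; *ₗ-zeroˡ     = λ _ → ≈⇒~ (B.*ₗ-zeroˡ _)
            ; *ₗ-distribʳ  = λ _ _ _ → ≈⇒~ (B.*ₗ-distribʳ _ _ _)
            ; *ₗ-identityˡ = λ _ → ≈⇒~ (B.*ₗ-identityˡ _)
            ; *ₗ-assoc     = λ _ _ _ → ≈⇒~ (B.*ₗ-assoc _ _ _)
            ; *ₗ-zeroʳ     = λ _ → ≈⇒~ (B.*ₗ-zeroʳ _)
            ; *ₗ-distribˡ  = λ _ _ _ → ≈⇒~ (B.*ₗ-distribˡ _ _ _)
            }
          }
        ; -ᴹ‿cong    = ~-neg
        ; -ᴹ‿inverse = (λ _ → ≈⇒~ (B.-ᴹ‿inverseˡ _)) , λ _ → ≈⇒~ (B.-ᴹ‿inverseʳ _)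
        }
      }

  toZero : ∀ {a ℓa} (A : Mod a ℓa) → LinearMap A (Zero.leftModule {c} {ℓ} {R = ring})
  toZero A = mkLinear A Zero.leftModule _ (λ _ → _) (λ _ _ → _) _ (λ _ → _) (λ _ _ → _)

  module _ {n} (D : Digraph n) where

    MC : ℕ → ℕ → Mod c (c ⊔ ℓ)
    MC k l = Free (Generator D k l)

    -- The index i : Fin m stands for the interior position i + 1 of the tuple
    -- (x₀ , … , x_{m+1}).
    face : ∀ {m l} → Fin m → Generator D (suc m) l → Term (Generator D m l)
    face {m} {l} i (generator t t≢ t-len) = keep (len? D (removeAt t (suc (inject₁ i))) l)
      where
      keep : Dec (Len D (removeAt t (suc (inject₁ i))) l) → Term (Generator D m l)
      keep (yes p) = gen (generator (removeAt t (suc (inject₁ i)))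
                                    (proper-removeAt D t i t≢ t-len p refl) p)
      keep (no  _) = 𝟎

    ∂-gen : ∀ m l → Generator D (suc m) l → Term (Generator D m l)
    ∂-gen m l x = sum λ i → ((- 1#) ^ suc (toℕ i)) ⊙ face i x
      where
      open Sum (LeftModule.+ᴹ-commutativeMonoid (MC m l)) using (sum)
      open Exp semiring using (_^_)

    ∂ : ∀ m l → LinearMap (MC (suc m) l) (MC m l)
    ∂ m l = extend (MC m l) (∂-gen m l)

    Distinct : ∀ k l → Pred (Term (Generator D k l)) c
    Distinct k l x = ∃ λ g → Unique (Generator.tuple g) × x ≡ gen g

    EMC : ℕ → ℕ → Mod (c ⊔ ℓ) (c ⊔ ℓ)
    EMC k l = Span (MC k l) (Distinct k l)

    private
      sum-span : ∀ {m l r} (v : Fin r → Term (Generator D m l)) →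
                 (∀ i → InSpan (MC m l) (Distinct m l) (v i)) →
                 InSpan (MC m l) (Distinct m l)
                   (Sum.sum (LeftModule.+ᴹ-commutativeMonoid (MC m l)) v)
      sum-span {r = zero}  v p = zeroˢ
      sum-span {r = suc r} v p = addˢ (p zero) (sum-span (λ i → v (suc i)) (λ i → p (suc i)))

      face-span : ∀ {m l} (i : Fin m) (g : Generator D (suc m) l) →
                  Unique (Generator.tuple g) → InSpan (MC m l) (Distinct m l) (face i g)
      face-span {l = l} i (generator t _ _) u with len? D (removeAt t (suc (inject₁ i))) l
      ... | yes _ = incl (_ , unique-removeAt (suc (inject₁ i)) u , refl)
      ... | no  _ = zeroˢ

      ∂-span : ∀ {m l x} → Distinct (suc m) l x →
               InSpan (MC m l) (Distinct m l) (LinearMap.⟦_⟧ (∂ m l) x)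
      ∂-span (g , u , refl) = sum-span _ λ i → scalˢ _ (face-span i g u)

    ∂ᴱ : ∀ m l → LinearMap (EMC (suc m) l) (EMC m l)
    ∂ᴱ m l = restrict (Distinct (suc m) l) (Distinct m l) (∂ m l) ∂-span

    -- In degree 0 the outgoing differential is the map to the zero module.
    MH : ℕ → ℕ → Mod (c ⊔ ℓ) (c ⊔ ℓ)
    MH zero    l = Homology (∂ 0 l) (toZero (MC 0 l))
    MH (suc k) l = Homology (∂ (suc k) l) (∂ k l)

    EMH : ℕ → ℕ → Mod (c ⊔ ℓ) (c ⊔ ℓ)
    EMH zero    l = Homology (∂ᴱ 0 l) (toZero (EMC 0 l))
    EMH (suc k) l = Homology (∂ᴱ (suc k) l) (∂ᴱ k l)

    Diagonal RegularlyDiagonal : Set (c ⊔ ℓ)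
    Diagonal          = ∀ k l → k ≢ l → IsZero (MH k l)
    RegularlyDiagonal = ∀ k l → k ≢ l → IsZero (EMH k l)

expectedRank : ∀ {n} → Graph n → ℕ → ℕ → ℕ
expectedRank G 0 0 = Graph.∣V∣ G
expectedRank G 1 1 = Graph.∣E∣ G
expectedRank G _ _ = 0

{-# OPTIONS --safe #-}
module Submission where

-- In an alternating orientation no vertex has both an incoming and an outgoing
-- arc, so every finite distance between distinct vertices is 1 and a generator
-- has at most two entries: the generators are the vertices, in bidegree (0 , 0),
-- and the arcs, in bidegree (1 , 1).  All their tuples have distinct entries, and
-- every differential vanishes since its source or its target has no generators.

open import Defs
open import Algebra.Bundles using (CommutativeRing)
open import Data.Nat.Base using (ℕ)
open import Data.Product.Base using (_×_)
open import Relation.Nullary using (¬_)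

import Algebra.Module.Construct.TensorUnit as TensorUnit
open import Algebra.Module.Bundles using (LeftModule)
import Algebra.Properties.CommutativeMonoid.Sum as Sum
open import Data.Empty using (⊥-elim)
open import Data.Fin.Base as Fin using (Fin; zero; suc)
import Data.Fin.Properties as Fin
open import Data.Fin.Subset.Properties using (_∈?_; x∉p⇒x∈∁p)
open import Data.List.Base using (List; []; _∷_; length; lookup; allFin; cartesianProduct)
open import Data.List.Membership.Propositional using (_∈_)
open import Data.List.Membership.Propositional.Properties
  using (∈-allFin; ∈-cartesianProduct⁺; ∈-filter⁺; ∈-filter⁻; ∈-lookup)
import Data.List.Relation.Unary.All as All
open import Data.List.Relation.Unary.AllPairs using (_∷_)
open import Data.List.Relation.Unary.Any using (index)
open import Data.List.Relation.Unary.Any.Properties using (lookup-index)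
open import Data.List.Relation.Unary.Unique.Propositional renaming (Unique to Uniqueᴸ) using ()
open import Data.List.Relation.Unary.Unique.Propositional.Properties
  using (allFin⁺; cartesianProduct⁺; filter⁺)
open import Data.Nat.Base using (zero; suc; _≤_; z≤n; s≤s)
open import Data.Nat.Properties using (_≟_; _≤?_; 1+n≢n)
open import Data.Product.Base using (_,_; proj₁; proj₂; ∃)
open import Data.Sum.Base using (_⊎_; inj₁; inj₂)
open import Data.Vec.Base using (Vec; []; _∷_)
open import Data.Vec.Relation.Unary.All using ([]; _∷_)
open import Data.Vec.Relation.Unary.AllPairs.Core using ([]; _∷_)
open import Data.Vec.Relation.Unary.Linked as Linked using (Linked; [-]; _∷_)
open import Data.Vec.Relation.Unary.Unique.Propositional using (Unique)
open import Function.Base using (_∘_)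
open import Function.Bundles using (_↔_; Inverse; mk↔ₛ′)
open import Relation.Binary.Definitions using (tri<; tri≈; tri>)
open import Relation.Binary.PropositionalEquality
  using (_≡_; _≢_; refl; sym; trans; cong; subst)
import Relation.Binary.Reasoning.Setoid as SetoidReasoning
open import Relation.Nullary using (yes; no)
open import Relation.Nullary.Decidable using (recompute; ¬?; _×-dec_)

-- Lists as finite enumerations.

lookup-injective : ∀ {a} {A : Set a} {xs : List A} → Uniqueᴸ xs →
                   ∀ i j → lookup xs i ≡ lookup xs j → i ≡ j
lookup-injective (_ ∷ _)   zero    zero    _  = refl
lookup-injective (x∉ ∷ _)  zero    (suc j) eq = ⊥-elim (All.lookup x∉ (∈-lookup j) eq)
lookup-injective (x∉ ∷ _)  (suc i) zero    eq = ⊥-elim (All.lookup x∉ (∈-lookup i) (sym eq))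
lookup-injective (_ ∷ xs!) (suc i) (suc j) eq = cong suc (lookup-injective xs! i j eq)

length≡0⇒∉ : ∀ {a} {A : Set a} {xs : List A} {x} → length xs ≡ 0 → ¬ x ∈ xs
length≡0⇒∉ {xs = []} _ ()

-- Linear algebra: sums, linear combinations, and bases of free modules, spans and homology.

module _ {c ℓ} (R : CommutativeRing c ℓ) where
  private module R = CommutativeRing R

  -- The Kronecker delta, by recursion instead of a decision, so that `sum-δ` is a plain induction
  -- on the index.
  δ : ∀ {r} → Fin r → Fin r → R.Carrier
  δ zero    zero    = R.1#
  δ zero    (suc _) = R.0#
  δ (suc _) zero    = R.0#
  δ (suc i) (suc j) = δ i j

  module _ {m ℓm} (M : Mod R m ℓm) where
    open LeftModule M
    open Sum +ᴹ-commutativeMonoid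
    open SetoidReasoning ≈ᴹ-setoid

    sum-0*ₗ : ∀ {r} (v : Fin r → Carrierᴹ) → sum (λ i → R.0# *ₗ v i) ≈ᴹ 0ᴹ
    sum-0*ₗ {r} v = ≈ᴹ-trans (sum-cong-≋ (λ i → *ₗ-zeroˡ (v i))) (sum-replicate-zero r)

    sum-δ : ∀ {r} (i : Fin r) (v : Fin r → Carrierᴹ) → sum (λ j → δ i j *ₗ v j) ≈ᴹ v i
    sum-δ zero v = begin
      R.1# *ₗ v zero +ᴹ sum (λ j → R.0# *ₗ v (suc j))
        ≈⟨ +ᴹ-cong (*ₗ-identityˡ _) (sum-0*ₗ (v ∘ suc)) ⟩
      v zero +ᴹ 0ᴹ
        ≈⟨ +ᴹ-identityʳ _ ⟩
      v zero ∎
    sum-δ (suc i) v = begin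
      R.0# *ₗ v zero +ᴹ sum (λ j → δ i j *ₗ v (suc j))
        ≈⟨ +ᴹ-cong (*ₗ-zeroˡ _) (sum-δ i (v ∘ suc)) ⟩
      0ᴹ +ᴹ v (suc i)
        ≈⟨ +ᴹ-identityˡ _ ⟩
      v (suc i) ∎

    *ₗ-distribˡ-sum : ∀ {r} s (v : Fin r → Carrierᴹ) → s *ₗ sum v ≈ᴹ sum (λ i → s *ₗ v i)
    *ₗ-distribˡ-sum {zero}  s v = *ₗ-zeroʳ s
    *ₗ-distribˡ-sum {suc r} s v =
      ≈ᴹ-trans (*ₗ-distribˡ s _ _) (+ᴹ-congˡ (*ₗ-distribˡ-sum s (v ∘ suc)))

    -1*ₗ : ∀ x → -ᴹ x ≈ᴹ (R.- R.1#) *ₗ x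
    -1*ₗ x = begin
      -ᴹ x                                          ≈⟨ +ᴹ-identityʳ _ ⟨
      -ᴹ x +ᴹ 0ᴹ                                    ≈⟨ +ᴹ-congˡ (*ₗ-zeroˡ x) ⟨
      -ᴹ x +ᴹ R.0# *ₗ x                             ≈⟨ +ᴹ-congˡ (*ₗ-congʳ (R.-‿inverseʳ R.1#)) ⟨
      -ᴹ x +ᴹ (R.1# R.+ R.- R.1#) *ₗ x              ≈⟨ +ᴹ-congˡ (*ₗ-distribʳ x _ _) ⟩
      -ᴹ x +ᴹ (R.1# *ₗ x +ᴹ (R.- R.1#) *ₗ x)        ≈⟨ +ᴹ-congˡ (+ᴹ-congʳ (*ₗ-identityˡ x)) ⟩
      -ᴹ x +ᴹ (x +ᴹ (R.- R.1#) *ₗ x)                ≈⟨ +ᴹ-assoc _ _ _ ⟨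
      (-ᴹ x +ᴹ x) +ᴹ (R.- R.1#) *ₗ x                ≈⟨ +ᴹ-congʳ (-ᴹ‿inverseˡ x) ⟩
      0ᴹ +ᴹ (R.- R.1#) *ₗ x                         ≈⟨ +ᴹ-identityˡ _ ⟩
      (R.- R.1#) *ₗ x                               ∎

    rank-0⇒IsZero : HasRank R M 0 → IsZero R M
    rank-0⇒IsZero (_ , b-basis) x = proj₂ (IsBasis.spanning b-basis x)

    -- The `spanning` condition of `IsBasis` for a single element; the closure lemmas after it allow
    -- spanning to be proved by induction on `Term`.
    LinearCombination : ∀ {r} → (Fin r → Carrierᴹ) → Carrierᴹ → Set _
    LinearCombination {r} b x = ∃ λ (a : Fin r → R.Carrier) → x ≈ᴹ sum (λ i → a i *ₗ b i)

    module _ {r} {b : Fin r → Carrierᴹ} where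

      lc-0 : LinearCombination b 0ᴹ
      lc-0 = (λ _ → R.0#) , ≈ᴹ-sym (sum-0*ₗ b)

      lc-basis : ∀ i → LinearCombination b (b i)
      lc-basis i = δ i , ≈ᴹ-sym (sum-δ i b)

      lc-+ : ∀ {x y} → LinearCombination b x → LinearCombination b y →
             LinearCombination b (x +ᴹ y)
      lc-+ {x} {y} (a , p) (a′ , q) = (λ i → a i R.+ a′ i) , (begin
        x +ᴹ y                                               ≈⟨ +ᴹ-cong p q ⟩
        sum (λ i → a i *ₗ b i) +ᴹ sum (λ i → a′ i *ₗ b i)    ≈⟨ ∑-distrib-+ (λ i → a i *ₗ b i) (λ i → a′ i *ₗ b i) ⟨
        sum (λ i → a i *ₗ b i +ᴹ a′ i *ₗ b i)                ≈⟨ sum-cong-≋ (λ i → *ₗ-distribʳ (b i) _ _) ⟨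
        sum (λ i → (a i R.+ a′ i) *ₗ b i)                    ∎)

      lc-* : ∀ s {x} → LinearCombination b x → LinearCombination b (s *ₗ x)
      lc-* s {x} (a , p) = (λ i → s R.* a i) , (begin
        s *ₗ x                          ≈⟨ *ₗ-congˡ p ⟩
        s *ₗ sum (λ i → a i *ₗ b i)     ≈⟨ *ₗ-distribˡ-sum s (λ i → a i *ₗ b i) ⟩
        sum (λ i → s *ₗ (a i *ₗ b i))   ≈⟨ sum-cong-≋ (λ i → *ₗ-assoc s (a i) (b i)) ⟨
        sum (λ i → (s R.* a i) *ₗ b i)  ∎)

      lc-neg : ∀ {x} → LinearCombination b x → LinearCombination b (-ᴹ x)
      lc-neg {x} p with lc-* (R.- R.1#) p
      ... | a , q = a , ≈ᴹ-trans (-1*ₗ x) q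

  module _ {a ℓa b ℓb} (A : Mod R a ℓa) (B : Mod R b ℓb) where
    private
      module A = LeftModule A
      module B = LeftModule B

    -- Stated up to `≡`: the maps `h` of interest, `proj₁` and `extend-fun`, preserve zero and
    -- addition by computation, so both hypotheses become `refl`.
    sum-homo : (h : A.Carrierᴹ → B.Carrierᴹ) → h A.0ᴹ ≡ B.0ᴹ →
               (∀ x y → h (x A.+ᴹ y) ≡ h x B.+ᴹ h y) →
               ∀ {r} (v : Fin r → A.Carrierᴹ) →
               h (Sum.sum A.+ᴹ-commutativeMonoid v) ≡ Sum.sum B.+ᴹ-commutativeMonoid (h ∘ v)
    sum-homo h h0 h+ {zero}  v = h0
    sum-homo h h0 h+ {suc r} v =
      trans (h+ _ _) (cong (h (v zero) B.+ᴹ_) (sum-homo h h0 h+ (v ∘ suc)))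

    linear-zero : (f : LinearMap R A B) → IsZero R A ⊎ IsZero R B →
                  ∀ x → LinearMap.⟦_⟧ f x B.≈ᴹ B.0ᴹ
    linear-zero f (inj₁ A≈0) x = B.≈ᴹ-trans (⟦⟧-cong (A≈0 x)) 0ᴹ-homo
      where open LinearMap f
    linear-zero f (inj₂ B≈0) x = B≈0 _

  -- Independence uses the dual basis: the universal property of `Free` turns the `i`-th coordinate
  -- into a map to the ring, which sends a relation to its `i`-th coefficient.
  free-rank : ∀ {t} {T : Set t} {r} → Fin r ↔ T → HasRank R (Free R T) r
  free-rank {T = T} {r} φ = gen ∘ to , record { spanning = span ; independent = indep }
    where
    open Inverse φ using (to; from; strictlyInverseˡ; strictlyInverseʳ)

    span : ∀ x → LinearCombination (Free R T) (gen ∘ to) x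
    span (gen t) = subst (LinearCombination (Free R T) (gen ∘ to) ∘ gen)
                         (strictlyInverseˡ t) (lc-basis (Free R T) (from t))
    span 𝟎       = lc-0 (Free R T)
    span (x ⊕ y) = lc-+ (Free R T) (span x) (span y)
    span (⊖ x)   = lc-neg (Free R T) (span x)
    span (s ⊙ x) = lc-* (Free R T) s (span x)

    Rᴹ : Mod R c ℓ
    Rᴹ = TensorUnit.leftModule

    indep : ∀ (a : Fin r → R.Carrier) →
            _≋_ R T (Sum.sum (LeftModule.+ᴹ-commutativeMonoid (Free R T)) λ i → a i ⊙ gen (to i)) 𝟎 →
            ∀ i → a i R.≈ R.0#
    indep a eq i = begin
      a i
        ≈⟨ sum-δ Rᴹ i a ⟨
      sum (λ j → δ i j R.* a j)
        -- The factor `δ i (from (to j))` is the value of `coordinate` at `to j`, so the sum becomes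
        -- the image of the relation.
        ≈⟨ sum-cong-≋ (λ j → R.trans (R.*-comm _ _)
             (R.*-congˡ (R.reflexive (cong (δ i) (sym (strictlyInverseʳ j)))))) ⟩
      sum (λ j → a j R.* δ i (from (to j)))
        ≡⟨ sum-homo (Free R T) Rᴹ (extend-fun R Rᴹ coordinate) refl (λ _ _ → refl)
             (λ j → a j ⊙ gen (to j)) ⟨
      extend-fun R Rᴹ coordinate (Sum.sum (LeftModule.+ᴹ-commutativeMonoid (Free R T)) λ j → a j ⊙ gen (to j))
        ≈⟨ extend-cong R Rᴹ coordinate eq ⟩
      R.0# ∎
      where
      open Sum (LeftModule.+ᴹ-commutativeMonoid Rᴹ)
      open SetoidReasoning R.setoid
      coordinate : T → R.Carrier
      coordinate t = δ i (from t)

  -- Equality in `Span` is equality of first components, so a basis of `M` lying in `S` keeps its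
  -- coefficients.
  span-rank : ∀ {m ℓm s r} (M : Mod R m ℓm) (S : LeftModule.Carrierᴹ M → Set s)
              (M-rank : HasRank R M r) → (∀ i → S (proj₁ M-rank i)) →
              HasRank R (Span R M S) r
  span-rank {r = r} M S (b , b-basis) b∈S = β , record
    { spanning    = λ (x , _) → let a , eq = spanning x in
        a , ≈ᴹ-trans eq (≈ᴹ-reflexive (sym (proj₁-sum a)))
    ; independent = λ a eq → independent a (≈ᴹ-trans (≈ᴹ-reflexive (sym (proj₁-sum a))) eq)
    }
    where
    open LeftModule M
    module S = LeftModule (Span R M S)
    open IsBasis b-basis

    β : Fin r → S.Carrierᴹ
    β i = b i , incl (b∈S i)

    proj₁-sum : ∀ a → proj₁ (Sum.sum S.+ᴹ-commutativeMonoid (λ i → a i S.*ₗ β i))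
                    ≡ Sum.sum +ᴹ-commutativeMonoid (λ i → a i *ₗ b i)
    proj₁-sum a = sum-homo (Span R M S) M proj₁ refl (λ _ _ → refl) (λ i → a i S.*ₗ β i)

  -- When `g` vanishes every element is a cycle, and when `f` vanishes homologous cycles are equal;
  -- the basis of `B` therefore serves unchanged.
  homology-rank : ∀ {a ℓa b ℓb d ℓd r} {A : Mod R a ℓa} {B : Mod R b ℓb} {C : Mod R d ℓd}
                  (f : LinearMap R A B) (g : LinearMap R B C) →
                  (∀ w → LeftModule._≈ᴹ_ B (LinearMap.⟦_⟧ f w) (LeftModule.0ᴹ B)) →
                  (∀ x → LeftModule._≈ᴹ_ C (LinearMap.⟦_⟧ g x) (LeftModule.0ᴹ C)) →
                  HasRank R B r → HasRank R (Homology R f g) r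
  homology-rank {A = A} {B} {C} f g f≈0 g≈0 (b , b-basis) = β , record
    { spanning    = λ (x , _) → let a , eq = spanning x in
        -- Any witness would do here, since every boundary is zero.
        a , A.0ᴹ , (begin
          x                                   ≈⟨ eq ⟩
          sum (λ i → a i B.*ₗ b i)            ≡⟨ proj₁-sum a ⟨
          proj₁ (combination a)               ≈⟨ B.+ᴹ-identityʳ _ ⟨
          proj₁ (combination a) B.+ᴹ B.0ᴹ     ≈⟨ B.+ᴹ-congˡ (f≈0 _) ⟨
          proj₁ (combination a) B.+ᴹ f.⟦ A.0ᴹ ⟧  ∎)
    ; independent = λ a (w , eq) → independent a (begin
        sum (λ i → a i B.*ₗ b i)  ≡⟨ proj₁-sum a ⟨
        proj₁ (combination a)     ≈⟨ eq ⟩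
        B.0ᴹ B.+ᴹ f.⟦ w ⟧         ≈⟨ B.+ᴹ-identityˡ _ ⟩
        f.⟦ w ⟧                   ≈⟨ f≈0 w ⟩
        B.0ᴹ                      ∎)
    }
    where
    module A = LeftModule A
    module B = LeftModule B
    module f = LinearMap f
    module H = LeftModule (Homology R f g)
    open IsBasis b-basis
    open Sum B.+ᴹ-commutativeMonoid using (sum)
    open SetoidReasoning B.≈ᴹ-setoid

    β : Fin _ → H.Carrierᴹ
    β i = b i , g≈0 (b i)

    combination : (Fin _ → R.Carrier) → H.Carrierᴹ
    combination a = Sum.sum H.+ᴹ-commutativeMonoid (λ i → a i H.*ₗ β i)

    proj₁-sum : ∀ a → proj₁ (combination a) ≡ sum (λ i → a i B.*ₗ b i)
    proj₁-sum a = sum-homo (Homology R f g) B proj₁ refl (λ _ _ → refl) (λ i → a i H.*ₗ β i)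

-- The expected ranks off the diagonal.

expectedRank-off-diagonal : ∀ {n} (G : Graph n) k l → k ≢ l → expectedRank G k l ≡ 0
expectedRank-off-diagonal G zero          zero          k≢l = ⊥-elim (k≢l refl)
expectedRank-off-diagonal G zero          (suc l)       k≢l = refl
expectedRank-off-diagonal G (suc zero)    zero          k≢l = refl
expectedRank-off-diagonal G (suc zero)    (suc zero)    k≢l = ⊥-elim (k≢l refl)
expectedRank-off-diagonal G (suc zero)    (suc (suc l)) k≢l = refl
expectedRank-off-diagonal G (suc (suc k)) l             k≢l = refl

-- Generators of a digraph in which no arc follows another.

module _ {n} (D : Digraph n) (no-path : ∀ {x y z} → Digraph.Arc D x y → ¬ Digraph.Arc D y z) where
  open Digraph D

  -- A walk of length 0 would identify the ends, and one of length at least 2 would begin with two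
  -- consecutive arcs.
  dist⇒arc : ∀ {x y m} → x ≢ y → Dist D x y m → m ≡ 1 × Arc x y
  dist⇒arc x≢y ([]        , _) = ⊥-elim (x≢y refl)
  dist⇒arc x≢y (a ∷ []    , _) = refl , a
  dist⇒arc x≢y (a ∷ b ∷ _ , _) = ⊥-elim (no-path a b)

  -- Every step has distance 1, so the length counts the steps.
  tuple-arcs : ∀ {k l} {t : Vec (Fin n) (suc k)} → Linked _≢_ t → Len D t l →
               l ≡ k × Linked Arc t
  tuple-arcs [-]          [-]     = refl , [-]
  tuple-arcs (x≢y ∷ t≢) (d ∷ p) with dist⇒arc x≢y d | tuple-arcs t≢ p
  ... | refl , a | refl , as = refl , a ∷ as

  linked-arcs-short : ∀ {k} {t : Vec (Fin n) (suc k)} → Linked Arc t → k ≤ 1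
  linked-arcs-short [-]                             = z≤n
  linked-arcs-short {t = _ ∷ _ ∷ []}    (_ ∷ _)     = s≤s z≤n
  linked-arcs-short {t = _ ∷ _ ∷ _ ∷ _} (a ∷ b ∷ _) = ⊥-elim (no-path a b)

  -- The proofs in a generator are irrelevant, so they can only yield decidable conclusions, through
  -- `recompute`; the same device recurs in `generator-arc` and `generator-distinct`.
  generator-degree : ∀ {k l} → Generator D k l → l ≡ k × k ≤ 1
  generator-degree {k} {l} (generator t t≢ t-len) =
    recompute ((l ≟ k) ×-dec (k ≤? 1))
      (let l≡k , as = tuple-arcs t≢ t-len in l≡k , linked-arcs-short as)

  generator-arc : ∀ {x y} → .(Linked _≢_ (x ∷ y ∷ [])) → .(Len D (x ∷ y ∷ []) 1) → Arc x y
  generator-arc {x} {y} t≢ t-len =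
    recompute (arc? x y) (Linked.head (proj₂ (tuple-arcs t≢ t-len)))

  arc-generator : ∀ {x y} → x ≢ y → Arc x y → Generator D 1 1
  arc-generator {x} {y} x≢y a = generator (x ∷ y ∷ []) (x≢y ∷ [-])
    -- A shorter walk has length 0 and would force `x ≡ y`.
    ((a ∷ [] , λ { (s≤s z≤n) [] → x≢y refl }) ∷ [-])

  -- With at most two entries, distinct neighbours are already pairwise distinct entries. This is
  -- what carries the basis of `MC` over to `EMC`.
  generator-distinct : ∀ {k l} (g : Generator D k l) → Unique (Generator.tuple g)
  generator-distinct (generator (_ ∷ []) _ _)     = [] ∷ []
  generator-distinct (generator (x ∷ y ∷ []) t≢ _) =
    (recompute (¬? (x Fin.≟ y)) (Linked.head t≢) ∷ []) ∷ [] ∷ []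
  generator-distinct g@(generator (_ ∷ _ ∷ _ ∷ _) _ _) with generator-degree g
  ... | _ , s≤s ()

-- Alternating orientations and the list of edges.

module _ {n} {G : Graph n} (o : Orientation G) where
  open Graph G
  open Orientation o
  private D = digraph

  adj⇒≢ : ∀ {x y} → Adj x y → x ≢ y
  adj⇒≢ e refl = irrefl e

  -- The middle vertex `y` would be a head and a tail at once: in `V` the arc `a` contradicts
  -- indegree 0, outside `V` the arc `b` contradicts outdegree 0.
  alternating⇒no-path : Alternating o → ∀ {x y z} → Arc x y → ¬ Arc y z
  alternating⇒no-path (V , V-in , W-out) {x} {y} {z} a b with y ∈? V
  ... | yes y∈V = length≡0⇒∉ (V-in y y∈V)
                    (∈-filter⁺ (λ u → Digraph.arc? D u y) (∈-allFin x) a)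
  ... | no  y∉V = length≡0⇒∉ (W-out y (x∉p⇒x∈∁p y∉V))
                    (∈-filter⁺ (λ u → Digraph.arc? D y u) (∈-allFin z) b)

  -- The test by which `edges` filters, named so that lemmas about `filter` apply to `edges`.
  edge? = λ ((x , y) : Fin n × Fin n) → (x Fin.<? y) ×-dec adj? x y

  edges-unique : Uniqueᴸ edges
  edges-unique = filter⁺ edge? (cartesianProduct⁺ (allFin⁺ n) (allFin⁺ n))

  ∈-edges : ∀ {x y} → x Fin.< y → Adj x y → (x , y) ∈ edges
  ∈-edges x<y e = ∈-filter⁺ edge? (∈-cartesianProduct⁺ (∈-allFin _) (∈-allFin _)) (x<y , e)

  edges-sound : ∀ {e} → e ∈ edges → proj₁ e Fin.< proj₂ e × Adj (proj₁ e) (proj₂ e)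
  edges-sound = proj₂ ∘ ∈-filter⁻ edge? {xs = cartesianProduct (allFin n) (allFin n)}

  -- Counting generators by vertices and edges.

  module _ (no-path : ∀ {x y z} → Arc x y → ¬ Arc y z) where

    vertices↔generators : Fin ∣V∣ ↔ Generator D 0 0
    vertices↔generators = mk↔ₛ′ (λ x → generator (x ∷ []) [-] [-])
      (λ { (generator (x ∷ []) _ _) → x })
      (λ { (generator (x ∷ []) _ _) → refl }) (λ _ → refl)

    orient : ∀ {x y} → Adj x y → Generator D 1 1
    orient e with choice e
    ... | inj₁ a = arc-generator D no-path (adj⇒≢ e) a
    ... | inj₂ a = arc-generator D no-path (adj⇒≢ e ∘ sym) a

    -- Forgets the direction by putting the smaller end first, as in `edges`. The membership proof
    -- is kept because its `index` is the number of the edge.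
    arc-edge : ∀ {x y} → Arc x y → ∃ (_∈ edges)
    arc-edge {x} {y} a with Fin.<-cmp x y
    ... | tri< x<y _ _ = (x , y) , ∈-edges x<y (arc⇒adj a)
    ... | tri≈ _ x≡y _ = ⊥-elim (adj⇒≢ (arc⇒adj a) x≡y)
    ... | tri> _ _ y<x = (y , x) , ∈-edges y<x (adj-sym (arc⇒adj a))

    underlying : Generator D 1 1 → ∃ (_∈ edges)
    underlying (generator (x ∷ y ∷ []) t≢ t-len) = arc-edge (generator-arc D no-path t≢ t-len)

    -- `choice` may depend on the adjacency proof, and the one recovered from the list need not come
    -- from `a`. For every `e`, however, `asym` excludes the direction opposite to `a`.
    orient-arc-edge : ∀ {x y} (a : Arc x y) →
                      let (u , v) , _ = arc-edge a in (e : Adj u v) →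
                      Generator.tuple (orient e) ≡ x ∷ y ∷ []
    orient-arc-edge {x} {y} a e with Fin.<-cmp x y
    ... | tri≈ _ x≡y _ = ⊥-elim (adj⇒≢ (arc⇒adj a) x≡y)
    ... | tri< _ _ _ with choice e
    ...   | inj₁ _ = refl
    ...   | inj₂ b = ⊥-elim (asym a b)
    orient-arc-edge {x} {y} a e | tri> _ _ _ with choice e
    ...   | inj₁ b = ⊥-elim (asym a b)
    ...   | inj₂ _ = refl

    arc-edge-< : ∀ {x y} → x Fin.< y → (a : Arc x y) → proj₁ (arc-edge a) ≡ (x , y)
    arc-edge-< {x} {y} x<y a with Fin.<-cmp x y
    ... | tri< _ _ _   = refl
    ... | tri≈ x≮y _ _ = ⊥-elim (x≮y x<y)
    ... | tri> x≮y _ _ = ⊥-elim (x≮y x<y)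

    arc-edge-> : ∀ {x y} → x Fin.< y → (a : Arc y x) → proj₁ (arc-edge a) ≡ (x , y)
    arc-edge-> {x} {y} x<y a with Fin.<-cmp y x
    ... | tri< _ _ y≮x = ⊥-elim (y≮x x<y)
    ... | tri≈ _ _ y≮x = ⊥-elim (y≮x x<y)
    ... | tri> _ _ _   = refl

    -- The arc seen by `underlying` is recomputed and need not be the one given by `choice`; hence
    -- `arc-edge-<` and `arc-edge->` are stated for arbitrary arcs.
    underlying-orient : ∀ {x y} → x Fin.< y → (e : Adj x y) → proj₁ (underlying (orient e)) ≡ (x , y)
    underlying-orient x<y e with choice e
    ... | inj₁ a = arc-edge-< x<y _
    ... | inj₂ a = arc-edge-> x<y _

    edges↔generators : Fin ∣E∣ ↔ Generator D 1 1
    edges↔generators = mk↔ₛ′ to from to-from from-to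
      where
      edge : ∀ i → proj₁ (lookup edges i) Fin.< proj₂ (lookup edges i)
                 × Adj (proj₁ (lookup edges i)) (proj₂ (lookup edges i))
      edge i = edges-sound (∈-lookup i)

      to : Fin ∣E∣ → Generator D 1 1
      to i = orient (proj₂ (edge i))

      from : Generator D 1 1 → Fin ∣E∣
      from g = index (proj₂ (underlying g))

      lookup-from : ∀ g → proj₁ (underlying g) ≡ lookup edges (from g)
      lookup-from g = lookup-index (proj₂ (underlying g))

      -- The other fields are irrelevant, so `refl` suffices.
      tuple-injective : ∀ {g h : Generator D 1 1} → Generator.tuple g ≡ Generator.tuple h → g ≡ h
      tuple-injective refl = refl

      to-from : ∀ g → to (from g) ≡ g
      to-from g@(generator (x ∷ y ∷ []) t≢ t-len) = tuple-injective
        (orient-≡ (lookup-from g) (proj₂ (edge (from g))))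
        where
        a = generator-arc D no-path t≢ t-len
        -- The looked-up edge is generalised to a variable `e`, so that the equation can be matched
        -- with `refl` although the type of `p` depends on it.
        orient-≡ : ∀ {e} → proj₁ (arc-edge a) ≡ e → (p : Adj (proj₁ e) (proj₂ e)) →
                   Generator.tuple (orient p) ≡ x ∷ y ∷ []
        orient-≡ refl p = orient-arc-edge a p

      from-to : ∀ i → from (to i) ≡ i
      -- Since `edges` has no repetitions, it suffices to compare the entries at the two positions.
      from-to i = lookup-injective edges-unique _ _ (trans (sym (lookup-from (to i)))
        (underlying-orient (proj₁ (edge i)) (proj₂ (edge i))))

    no-generators : ∀ {k l} → ¬ (l ≡ k × k ≤ 1) → Fin 0 ↔ Generator D k l
    no-generators deg = mk↔ₛ′ (λ ()) (λ g → ⊥-elim (deg (generator-degree D no-path g)))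
      (λ g → ⊥-elim (deg (generator-degree D no-path g))) (λ ())

    -- The clauses are split finely enough for `expectedRank` to reduce in each; the empty cases
    -- violate `l ≡ k` or `k ≤ 1`.
    expectedRank↔generators : ∀ k l → Fin (expectedRank G k l) ↔ Generator D k l
    expectedRank↔generators zero          zero          = vertices↔generators
    expectedRank↔generators zero          (suc l)       = no-generators λ ()
    expectedRank↔generators (suc zero)    zero          = no-generators λ ()
    expectedRank↔generators (suc zero)    (suc zero)    = edges↔generators
    expectedRank↔generators (suc zero)    (suc (suc l)) = no-generators λ ()
    expectedRank↔generators (suc (suc k)) l             = no-generators λ { (_ , s≤s ()) }

    -- Ranks of the chain modules and of their homology.

    module _ {c ℓ} (R : CommutativeRing c ℓ) where

      MC-rank : ∀ k l → HasRank R (MC R D k l) (expectedRank G k l)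
      MC-rank k l = free-rank R (expectedRank↔generators k l)

      EMC-rank : ∀ k l → HasRank R (EMC R D k l) (expectedRank G k l)
      EMC-rank k l = span-rank R (MC R D k l) (Distinct R D k l) (MC-rank k l)
        -- The basis vectors of `MC-rank` are by definition `gen` of these generators, whence the
        -- `refl`.
        λ i → _ , generator-distinct D no-path (Inverse.to (expectedRank↔generators k l) i) , refl

      -- Abstract in the family `M`, to serve chain modules in `differential-zero` and homology in
      -- the final diagonality claims.
      off-diagonal-zero : ∀ {m ℓm} (M : ℕ → ℕ → Mod R m ℓm) →
                          (∀ k l → HasRank R (M k l) (expectedRank G k l)) →
                          ∀ k l → k ≢ l → IsZero R (M k l)
      off-diagonal-zero M M-rank k l k≢l = rank-0⇒IsZero R (M k l)
        (subst (HasRank R (M k l)) (expectedRank-off-diagonal G k l k≢l) (M-rank k l))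

      -- The bidegrees `(suc k , l)` and `(k , l)` cannot both be diagonal, so any linear map
      -- between these modules has a zero source or a zero target.
      differential-zero : ∀ {m ℓm} (M : ℕ → ℕ → Mod R m ℓm) →
                          (∀ k l → HasRank R (M k l) (expectedRank G k l)) →
                          ∀ k l (f : LinearMap R (M (suc k) l) (M k l)) x →
                          LeftModule._≈ᴹ_ (M k l) (LinearMap.⟦_⟧ f x) (LeftModule.0ᴹ (M k l))
      differential-zero M M-rank k l f = linear-zero R (M (suc k) l) (M k l) f cases
        where
        cases : IsZero R (M (suc k) l) ⊎ IsZero R (M k l)
        cases with k ≟ l
        ... | yes refl = inj₁ (off-diagonal-zero M M-rank (suc k) k 1+n≢n)
        ... | no  k≢l  = inj₂ (off-diagonal-zero M M-rank k l k≢l)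

      MH-rank : ∀ k l → HasRank R (MH R D k l) (expectedRank G k l)
      MH-rank zero    l = homology-rank R (∂ R D 0 l) (toZero R (MC R D 0 l))
        -- In degree 0 the outgoing map ends in the zero module, where the equality left as `_` is
        -- trivial.
        (differential-zero (MC R D) MC-rank 0 l (∂ R D 0 l)) _ (MC-rank 0 l)
      MH-rank (suc k) l = homology-rank R (∂ R D (suc k) l) (∂ R D k l)
        (differential-zero (MC R D) MC-rank (suc k) l (∂ R D (suc k) l))
        (differential-zero (MC R D) MC-rank k l (∂ R D k l)) (MC-rank (suc k) l)

      EMH-rank : ∀ k l → HasRank R (EMH R D k l) (expectedRank G k l)
      EMH-rank zero    l = homology-rank R (∂ᴱ R D 0 l) (toZero R (EMC R D 0 l))
        (differential-zero (EMC R D) EMC-rank 0 l (∂ᴱ R D 0 l)) _ (EMC-rank 0 l)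
      EMH-rank (suc k) l = homology-rank R (∂ᴱ R D (suc k) l) (∂ᴱ R D k l)
        (differential-zero (EMC R D) EMC-rank (suc k) l (∂ᴱ R D (suc k) l))
        (differential-zero (EMC R D) EMC-rank k l (∂ᴱ R D k l)) (EMC-rank (suc k) l)

lemma3p1 : ∀ {c ℓ} (R : CommutativeRing c ℓ) →
    ¬ CommutativeRing._≈_ R (CommutativeRing.1# R) (CommutativeRing.0# R) →
    ∀ {n} (G : Graph n) → Graph.Connected G →
    (o : Orientation G) → Alternating o →
    let D = Orientation.digraph o in
    (∀ (k l : ℕ) → HasRank R (MH R D k l) (expectedRank G k l)
    × HasRank R (EMH R D k l) (expectedRank G k l))
    × Diagonal R D
    × RegularlyDiagonal R D
lemma3p1 R _ G _ o alt =
  (λ k l → mh k l , emh k l) ,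
  off-diagonal-zero o no-path R (MH R D) mh ,
  off-diagonal-zero o no-path R (EMH R D) emh
  where
  D = Orientation.digraph o
  no-path = alternating⇒no-path o alt
  mh = MH-rank o no-path R
  emh = EMH-rank o no-path R
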